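{- Let $k\ge 1$ and let $s$ be a constellation of $j$ gaps in $\mathcal{G}(p_k)$ such that the sum of these $j$ gaps is less than $2p_{k+1}$. Let $S$ be the set of all constellations $\bar{s}$ which would produce $s$ upon one addition of adjacent gaps. Then the numbers $N_s(p)$ of occurrences of $s$ in $\mathcal{G}(p)$ satisfy $$N_s(p_{k+1})=\bigl(p_{k+1}-(j+1)\bigr)\cdot N_s(p_k)+\sum_{\bar{s}\in S}N_{\bar{s}}(p_k).$$
   Context: $p_i$ denotes the $i$-th prime ($p_1=2$), $\Pi_k=\prod_{i=1}^k p_i$, and $\Phi_k=\prod_{i=1}^k(p_i-1)$. The cycle of gaps $\mathcal{G}(p_k)=(g_{k,1},\ldots,g_{k,\Phi_k})$ is the sequence of differences between consecutive integers in $[1,\Pi_k+1]$ that are coprime to $\Pi_k$, in increasing order starting from $1$; it is regarded as a cycle, with indices extended periodically by $g_{k,i+\Phi_k}=g_{k,i}$. A constellation is a finite sequence $s=(a_1,\ldots,a_j)$ of positive integers (gaps). An occurrence of $s$ in $\mathcal{G}(p_k)$ is an index $i\in\{1,\ldots,\Phi_k\}$ with $g_{k,i+l-1}=a_l$ for $l=1,\ldots,j$; $N_s(p_k)$ is the number of such occurrences, and $s$ is a constellation in $\mathcal{G}(p_k)$ if it has at least one occurrence. A sequence $\bar{s}=(c_1,\ldots,c_{j+1})$ of $j+1$ positive integers produces $s$ upon one addition if for some $1\le i\le j$ replacing the adjacent entries $c_i,c_{i+1}$ by the single entry $c_i+c_{i+1}$ yields $s$. -}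

module Defs where

open import Data.Fin.Base using (Fin; zero; suc; toℕ)
import Data.Fin.Properties as Fin
open import Data.List.Base
  using (List; []; _∷_; _++_; map; filter; length; upTo; applyUpTo; head; drop)
open import Data.List.Membership.Propositional using (_∈_)
open import Data.List.Membership.Propositional.Properties
  using (∈-map⁺; ∈-map⁻; ∈-++⁺ˡ; ∈-++⁺ʳ; ∈-++⁻; ∈-upTo⁺; ∈-upTo⁻; ∈-filter⁺; ∈-filter⁻)
open import Data.List.Relation.Unary.All using ([]; _∷_)
open import Data.List.Relation.Unary.Unique.Propositional using (Unique; [])
import Data.List.Relation.Unary.Unique.Propositional.Properties as Unique
open import Data.Maybe.Base using (fromMaybe)
open import Data.Nat.Base
open import Data.Nat.Coprimality using (coprime?)
open import Data.Nat.Divisibility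
  using (_∣_; ∣m+n∣m⇒∣n; ∣1⇒≡1; m≤n⇒m!∣n!; ∣-trans; m∣m*n)
open import Data.Nat.DivMod using (_%_)
open import Data.Nat.ListAction using (sum; product)
open import Data.Nat.Primality using (Prime; prime?; ¬prime[0]; ¬prime[1])
open import Data.Nat.Primality.Factorisation using (PrimeFactorisation; factorise)
open import Data.Nat.Properties
open import Data.Product.Base using (∃-syntax; _×_; _,_)
open import Data.Sum.Base using (inj₁; inj₂)
open import Data.Vec.Base using (Vec; []; _∷_; lookup)
import Data.Vec.Properties as Vec
open import Data.Vec.Relation.Unary.All as All using (All; []; _∷_)
open import Relation.Binary.PropositionalEquality
open import Relation.Nullary using (¬_; Dec; yes; no; contradiction)

record NextPrime (n : ℕ) : Set where
  field
    value   : ℕ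
    above   : n < value
    isPrime : Prime value
    least   : ∀ r → n < r → Prime r → value ≤ r

open NextPrime

private
  primeAbove : ∀ n → ∃[ q ] n < q × Prime q
  primeAbove n = go (factorise (suc (n !)))
    where
    divisor>n : ∀ q → Prime q → q ∣ suc (n !) → n < q
    divisor>n zero      pr _  = contradiction pr ¬prime[0]
    divisor>n q@(suc m) pr q∣ = ≰⇒> λ q≤n → contradiction
      (subst Prime (∣1⇒≡1 (∣m+n∣m⇒∣n (subst (q ∣_) (+-comm 1 (n !)) q∣)
        (∣-trans (m∣m*n (m !)) (m≤n⇒m!∣n! q≤n)))) pr)
      ¬prime[1]

    go : PrimeFactorisation (suc (n !)) → ∃[ q ] n < q × Prime q
    go f with PrimeFactorisation.factors f
            | PrimeFactorisation.isFactorisation f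
            | PrimeFactorisation.factorsPrime f
    ... | []     | eq | _      = contradiction (sym eq) (<⇒≢ (s≤s (1≤n! n)))
    ... | q ∷ qs | eq | pr ∷ _ =
      q , divisor>n q pr (subst (q ∣_) (sym eq) (m∣m*n (product qs))) , pr

  leastPrimeFrom : ∀ d m → Prime (d + m) →
    ∃[ q ] m ≤ q × Prime q × (∀ r → m ≤ r → Prime r → q ≤ r)
  leastPrimeFrom d m pr with prime? m
  leastPrimeFrom d       m pr | yes pm = m , ≤-refl , pm , λ r m≤r _ → m≤r
  leastPrimeFrom zero    m pr | no ¬pm = contradiction pr ¬pm
  leastPrimeFrom (suc d) m pr | no ¬pm
    with leastPrimeFrom d (suc m) (subst Prime (sym (+-suc d m)) pr)
  ... | q , m<q , pq , min =
    q , <⇒≤ m<q , pq ,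
    λ r m≤r pr′ → min r (≤∧≢⇒< m≤r λ { refl → ¬pm pr′ }) pr′

nextPrime : ∀ n → NextPrime n
nextPrime n with primeAbove n
... | r , n<r , pr
  with leastPrimeFrom (r ∸ suc n) (suc n) (subst Prime (sym (m∸n+n≡m n<r)) pr)
... | q , n<q , pq , min =
  record { value = q ; above = n<q ; isPrime = pq ; least = min }

-- Indexed from 1, so that p 1 = 2; the value p 0 = 1 only starts the recursion.
p : ℕ → ℕ
p zero    = 1
p (suc i) = value (nextPrime (p i))

Π : ℕ → ℕ
Π zero    = 1
Π (suc k) = Π k * p (suc k)

Φ : ℕ → ℕ
Φ zero    = 1
Φ (suc k) = Φ k * (p (suc k) ∸ 1)

p-positive : ∀ i → 0 < p i
p-positive zero    = z<s
p-positive (suc i) = ≤-<-trans z≤n (above (nextPrime (p i)))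

Φ-nonZero : ∀ k → NonZero (Φ k)
Φ-nonZero zero    = _
Φ-nonZero (suc k) = m*n≢0 (Φ k) (p (suc k) ∸ 1)
  {{Φ-nonZero k}}
  {{>-nonZero (m<n⇒0<n∸m (≤-<-trans (p-positive k) (above (nextPrime (p k)))))}}

[1⋯_] : ℕ → List ℕ
[1⋯ n ] = applyUpTo suc n

differences : List ℕ → List ℕ
differences []           = []
differences (x ∷ [])     = []
differences (x ∷ y ∷ zs) = y ∸ x ∷ differences (y ∷ zs)

coprimes : ℕ → List ℕ
coprimes k = filter (λ n → coprime? n (Π k)) [1⋯ Π k + 1 ]

𝒢 : ℕ → List ℕ
𝒢 k = differences (coprimes k)

-- g k i is g_{k,i}, for i ≥ 1, extended with period Φ k.  The list 𝒢 k has
-- exactly Φ k entries, so the default value 0 of the lookup is never taken.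
g : ℕ → ℕ → ℕ
g k i = fromMaybe 0 (head (drop ((i ∸ 1) % Φ k) (𝒢 k)))
  where instance _ = Φ-nonZero k

IsConstellation : ∀ {j} → Vec ℕ j → Set
IsConstellation s = All (0 <_) s

-- The position l : Fin j counts from 0, whence g_{k,i+l} for g_{k,i+l-1}.
OccursAt : ∀ {j} → ℕ → Vec ℕ j → ℕ → Set
OccursAt k s i = ∀ l → g k (i + toℕ l) ≡ lookup s l

occursAt? : ∀ {j} k (s : Vec ℕ j) i → Dec (OccursAt k s i)
occursAt? k s i = Fin.all? λ l → g k (i + toℕ l) ≟ lookup s l

N : ∀ {j} → ℕ → Vec ℕ j → ℕ
N k s = length (filter (occursAt? k s) [1⋯ Φ k ])

IsConstellationIn : ∀ {j} → ℕ → Vec ℕ j → Set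
IsConstellationIn k s =
  IsConstellation s × ∃[ i ] 1 ≤ i × i ≤ Φ k × OccursAt k s i

addAdjacent : ∀ {j} → Fin j → Vec ℕ (suc j) → Vec ℕ j
addAdjacent zero    (c ∷ d ∷ cs) = c + d ∷ cs
addAdjacent (suc i) (c ∷ cs)     = c ∷ addAdjacent i cs

_Produces_ : ∀ {j} → Vec ℕ (suc j) → Vec ℕ j → Set
s̄ Produces s = IsConstellation s̄ × ∃[ i ] addAdjacent i s̄ ≡ s

-- A finite set, given by a predicate together with a duplicate-free list of
-- exactly the elements satisfying it.
record FiniteSet {A : Set} (P : A → Set) : Set where
  field
    elements : List A
    unique   : Unique elements
    sound    : ∀ {x} → x ∈ elements → P x
    complete : ∀ {x} → P x → x ∈ elements

open FiniteSet public using (elements)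

∑ : ∀ {A : Set} {P : A → Set} → FiniteSet P → (A → ℕ) → ℕ
∑ X f = sum (map f (elements X))

splitHead : ∀ {j} → ℕ → Vec ℕ j → ℕ → Vec ℕ (suc (suc j))
splitHead a as b = suc b ∷ a ∸ suc b ∷ as

splits : ∀ {j} → Vec ℕ j → List (Vec ℕ (suc j))
splits []       = []
splits (a ∷ as) = map (splitHead a as) (upTo (pred a)) ++ map (a ∷_) (splits as)

suc< : ∀ {a b} → b < pred a → suc b < a
suc< {suc a} b<a = s≤s b<a

splits-unique : ∀ {j} (s : Vec ℕ j) → Unique (splits s)
splits-unique []       = []
splits-unique (a ∷ as) = Unique.++⁺
  (Unique.map⁺ (λ eq → suc-injective (Vec.∷-injectiveˡ eq)) (Unique.upTo⁺ (pred a)))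
  (Unique.map⁺ Vec.∷-injectiveʳ (splits-unique as))
  disjoint
  where
  disjoint : ∀ {t} → ¬ (t ∈ map (splitHead a as) (upTo (pred a)) × t ∈ map (a ∷_) (splits as))
  disjoint (t∈ , t∈′) with ∈-map⁻ _ t∈ | ∈-map⁻ _ t∈′
  ... | b , b∈ , eq | _ , _ , eq′ =
    <⇒≢ (suc< (∈-upTo⁻ b∈)) (Vec.∷-injectiveˡ (trans (sym eq) eq′))

splits-sound : ∀ {j} (s : Vec ℕ j) {s̄} → s̄ ∈ splits s → ∃[ i ] addAdjacent i s̄ ≡ s
splits-sound (a ∷ as) s̄∈ with ∈-++⁻ (map (splitHead a as) (upTo (pred a))) s̄∈
... | inj₁ s̄∈ˡ with ∈-map⁻ _ s̄∈ˡ
...   | b , b∈ , refl = zero , cong (_∷ as) (m+[n∸m]≡n (<⇒≤ (suc< (∈-upTo⁻ b∈))))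
splits-sound (a ∷ as) s̄∈ | inj₂ s̄∈ʳ with ∈-map⁻ _ s̄∈ʳ
...   | t , t∈ , refl with splits-sound as t∈
...     | i , eq = suc i , cong (a ∷_) eq

splits-complete : ∀ {j} (i : Fin j) {s̄} → IsConstellation s̄ → s̄ ∈ splits (addAdjacent i s̄)
splits-complete zero {suc b ∷ d ∷ cs} (_ ∷ 0<d ∷ _) = ∈-++⁺ˡ
  (subst (λ x → suc b ∷ x ∷ cs ∈ map (splitHead (suc b + d) cs) (upTo (b + d)))
    (m+n∸m≡n b d)
    (∈-map⁺ (splitHead (suc b + d) cs) (∈-upTo⁺ (m<m+n b 0<d))))
splits-complete (suc i) {c ∷ cs} (_ ∷ pos) =
  ∈-++⁺ʳ _ (∈-map⁺ (c ∷_) (splits-complete i pos))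

S : ∀ {j} (s : Vec ℕ j) → FiniteSet (_Produces s)
S s = record
  { elements = filter positive? (splits s)
  ; unique   = Unique.filter⁺ positive? (splits-unique s)
  ; sound    = λ s̄∈ → let s̄∈′ , pos = ∈-filter⁻ positive? s̄∈ in pos , splits-sound s s̄∈′
  ; complete = λ { (pos , i , refl) → ∈-filter⁺ positive? (splits-complete i pos) pos }
  }
  where positive? = All.all? (0 <?_)

{-# OPTIONS --safe #-}

-- Write c x for "x is coprime to Π k" and let q = p (k+1).  An occurrence of s
-- in 𝒢 k is a place where the bits of c spell the word 1 0…0 1 0…0 1 with the
-- gaps of s, and N k s counts such places x in one period of length Π k.  Over
-- q periods, passing from k to k + 1 turns off exactly the multiples of q, the
-- hits.  Since q and Π k are coprime, each position of an occurrence is hit in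
-- exactly one of the q periods.  A window of length at most 2q contains at most
-- one hit that turns off a bit of c, as two hits at distance q have opposite
-- parity.  Hence s occurs in 𝒢 (k+1) either where it already occurs in 𝒢 k and
-- none of its j + 1 ends is hit, or where the word of s with one 0 turned into
-- 1 occurs in 𝒢 k and that 1 is hit; and those words are the words of the
-- constellations that produce s upon one addition.

module Submission where

open import Defs

module _ where

  open import Data.Bool.Base using (Bool; true; false; not; _∧_; if_then_else_)
  open import Data.Empty using (⊥)
  open import Data.Fin.Base as Fin using (toℕ)
  open import Data.Fin.Properties using (all?)
  open import Data.List.Base
    using (List; []; _∷_; _++_; map; filter; head; drop; length; replicate; upTo; applyUpTo)
  open import Data.List.Properties
    using (map-++; map-∘; map-upTo; map-cong-local; length-++; length-replicate; filter-all; filter-accept)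
  import Data.List.Relation.Unary.All as List
  import Data.List.Relation.Unary.All.Properties as List
  open import Data.Maybe.Base using (fromMaybe)
  open import Data.Nat.Base
  open import Data.Nat.Coprimality
    using (Coprime; coprime?; 1-coprimeTo; coprime-Bézout; coprime-divisor)
  open import Data.Nat.Divisibility
  open import Data.Nat.DivMod
  open import Data.Nat.GCD using (module Bézout)
  open import Data.Nat.ListAction using (sum)
  open import Data.Nat.ListAction.Properties using (sum-++)
  open import Data.Nat.Primality
  open import Data.Nat.Properties
  open import Data.Nat.Tactic.RingSolver using (solve-∀)
  open import Data.Product.Base using (∃-syntax; _×_; _,_)
  open import Data.Sum.Base using (_⊎_; inj₁; inj₂)
  open import Data.Vec.Base as Vec using (Vec; []; _∷_; lookup)
  open import Data.Vec.Relation.Unary.All using (All; []; _∷_)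
  open import Function.Base using (_∘_)
  open import Relation.Binary.PropositionalEquality
  open import Relation.Nullary using (¬_; Dec; yes; no; does; contradiction)
  open import Relation.Nullary.Decidable using (dec-true; dec-false; ¬?; _×-dec_)
  open import Relation.Unary using (Decidable)

  open ≡-Reasoning

  ⟦_⟧ : Bool → ℕ
  ⟦ true ⟧  = 1
  ⟦ false ⟧ = 0

  -- Finite sums over initial segments of ℕ

  ∑< : ℕ → (ℕ → ℕ) → ℕ
  ∑< n f = sum (applyUpTo f n)

  +-interchange : ∀ a b c d → (a + b) + (c + d) ≡ (a + c) + (b + d)
  +-interchange = solve-∀

  ∑<-cong : ∀ n {f h : ℕ → ℕ} → (∀ i → f i ≡ h i) → ∑< n f ≡ ∑< n h
  ∑<-cong zero    eq = refl
  ∑<-cong (suc n) eq = cong₂ _+_ (eq 0) (∑<-cong n (eq ∘ suc))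

  ∑<-vanish : ∀ n {f : ℕ → ℕ} → (∀ {i} → i < n → f i ≡ 0) → ∑< n f ≡ 0
  ∑<-vanish zero    eq = refl
  ∑<-vanish (suc n) eq rewrite eq z<s = ∑<-vanish n (eq ∘ s<s)

  ∑<-zero : ∀ n → ∑< n (λ _ → 0) ≡ 0
  ∑<-zero n = ∑<-vanish n λ _ → refl

  ∑<-const : ∀ n a → ∑< n (λ _ → a) ≡ n * a
  ∑<-const zero    a = refl
  ∑<-const (suc n) a = cong (a +_) (∑<-const n a)

  ∑<-+ : ∀ n (f h : ℕ → ℕ) → ∑< n (λ i → f i + h i) ≡ ∑< n f + ∑< n h
  ∑<-+ zero    f h = refl
  ∑<-+ (suc n) f h = trans (cong (f 0 + h 0 +_) (∑<-+ n (f ∘ suc) (h ∘ suc)))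
    (+-interchange (f 0) (h 0) _ _)

  ∑<-*ʳ : ∀ n (f : ℕ → ℕ) a → ∑< n (λ i → f i * a) ≡ ∑< n f * a
  ∑<-*ʳ zero    f a = refl
  ∑<-*ʳ (suc n) f a = trans (cong (f 0 * a +_) (∑<-*ʳ n (f ∘ suc) a))
    (sym (*-distribʳ-+ a (f 0) _))

  ∑<-swap : ∀ m n (f : ℕ → ℕ → ℕ) → ∑< m (λ i → ∑< n (f i)) ≡ ∑< n (λ j → ∑< m (λ i → f i j))
  ∑<-swap zero    n f = sym (∑<-zero n)
  ∑<-swap (suc m) n f = trans (cong (∑< n (f 0) +_) (∑<-swap m n (f ∘ suc)))
    (sym (∑<-+ n (f 0) _))

  ∑<-++ : ∀ m n (f : ℕ → ℕ) → ∑< (m + n) f ≡ ∑< m f + ∑< n (λ i → f (m + i))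
  ∑<-++ zero    n f = refl
  ∑<-++ (suc m) n f = trans (cong (f 0 +_) (∑<-++ m n (f ∘ suc))) (sym (+-assoc (f 0) _ _))

  ∑<-suc : ∀ n (f : ℕ → ℕ) → ∑< (suc n) f ≡ ∑< n f + f n
  ∑<-suc zero    f = +-comm (f 0) 0
  ∑<-suc (suc n) f = trans (cong (f 0 +_) (∑<-suc n (f ∘ suc))) (sym (+-assoc (f 0) _ _))

  ∑<-blocks : ∀ q m (f : ℕ → ℕ) → ∑< (q * m) f ≡ ∑< q (λ t → ∑< m (λ x → f (t * m + x)))
  ∑<-blocks zero    m f = refl
  ∑<-blocks (suc q) m f = trans (∑<-++ m (q * m) f) (cong (∑< m f +_)
    (trans (∑<-blocks q m (λ i → f (m + i)))
      (∑<-cong q λ t → ∑<-cong m λ x → cong f (sym (+-assoc m (t * m) x)))))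

  ∑<-shift : ∀ m (f : ℕ → ℕ) → f m ≡ f 0 → ∑< m (f ∘ suc) ≡ ∑< m f
  ∑<-shift m f eq = +-cancelˡ-≡ (f 0) _ _
    (trans (∑<-suc m f) (trans (cong (∑< m f +_) eq) (+-comm _ (f 0))))

  ∑<-unique : ∀ n (b : ℕ → Bool) {i} → i < n → b i ≡ true →
    (∀ j → j < n → b j ≡ true → j ≡ i) → ∑< n (⟦_⟧ ∘ b) ≡ 1
  ∑<-unique (suc n) b {zero} _ bi uniq rewrite bi = cong suc (∑<-vanish n none)
    where
    none : ∀ {j} → j < n → ⟦ b (suc j) ⟧ ≡ 0
    none {j} j<n with b (suc j) in eq
    ... | false = refl
    ... | true  = contradiction (uniq (suc j) (s<s j<n) eq) λ ()
  ∑<-unique (suc n) b {suc i} (s<s i<n) bi uniq with b 0 in eq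
  ... | true  = contradiction (uniq 0 z<s eq) λ ()
  ... | false = ∑<-unique n (b ∘ suc) i<n bi λ j j<n bj → suc-injective (uniq (suc j) (s<s j<n) bj)

  -- Words

  -- A numerical indicator, 0 or 1, of `c` starting with the given word, so that occurrences are
  -- counted by summing over shifts of the stream.
  occ : (ℕ → Bool) → List Bool → ℕ
  occ c []          = 1
  occ c (true ∷ w)  = if c 0 then occ (c ∘ suc) w else 0
  occ c (false ∷ w) = if c 0 then 0 else occ (c ∘ suc) w

  occ-cong : ∀ {c d : ℕ → Bool} → (∀ i → c i ≡ d i) → ∀ w → occ c w ≡ occ d w
  occ-cong         eq []          = refl
  occ-cong {d = d} eq (true ∷ w)  rewrite eq 0 with d 0
  ... | true  = occ-cong (eq ∘ suc) w
  ... | false = refl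
  occ-cong {d = d} eq (false ∷ w) rewrite eq 0 with d 0
  ... | true  = refl
  ... | false = occ-cong (eq ∘ suc) w

  ∑true : (ℕ → ℕ) → List Bool → ℕ
  ∑true f []          = 0
  ∑true f (true ∷ w)  = f 0 + ∑true (f ∘ suc) w
  ∑true f (false ∷ w) = ∑true (f ∘ suc) w

  -- The sum of f i u over the words u obtained from w by turning one letter
  -- false, at position i, into true.
  ∑flip : (ℕ → List Bool → ℕ) → List Bool → ℕ
  ∑flip f []          = 0
  ∑flip f (true ∷ w)  = ∑flip (λ i u → f (suc i) (true ∷ u)) w
  ∑flip f (false ∷ w) = f 0 (true ∷ w) + ∑flip (λ i u → f (suc i) (false ∷ u)) w

  ∑true-cong : ∀ {f h : ℕ → ℕ} → (∀ i → f i ≡ h i) → ∀ w → ∑true f w ≡ ∑true h w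
  ∑true-cong eq []          = refl
  ∑true-cong eq (true ∷ w)  = cong₂ _+_ (eq 0) (∑true-cong (eq ∘ suc) w)
  ∑true-cong eq (false ∷ w) = ∑true-cong (eq ∘ suc) w

  ∑flip-cong : ∀ {f h : ℕ → List Bool → ℕ} → (∀ i u → f i u ≡ h i u) → ∀ w → ∑flip f w ≡ ∑flip h w
  ∑flip-cong eq []          = refl
  ∑flip-cong eq (true ∷ w)  = ∑flip-cong (λ i u → eq (suc i) (true ∷ u)) w
  ∑flip-cong eq (false ∷ w) = cong₂ _+_ (eq 0 _) (∑flip-cong (λ i u → eq (suc i) (false ∷ u)) w)

  ∑true-zero : ∀ {f : ℕ → ℕ} → (∀ i → f i ≡ 0) → ∀ w → ∑true f w ≡ 0
  ∑true-zero eq []          = refl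
  ∑true-zero eq (true ∷ w)  rewrite eq 0 = ∑true-zero (eq ∘ suc) w
  ∑true-zero eq (false ∷ w) = ∑true-zero (eq ∘ suc) w

  ∑flip-zero : ∀ {f : ℕ → List Bool → ℕ} → (∀ i u → f i u ≡ 0) → ∀ w → ∑flip f w ≡ 0
  ∑flip-zero eq []          = refl
  ∑flip-zero eq (true ∷ w)  = ∑flip-zero (λ i u → eq (suc i) (true ∷ u)) w
  ∑flip-zero eq (false ∷ w) rewrite eq 0 (true ∷ w) = ∑flip-zero (λ i u → eq (suc i) (false ∷ u)) w

  ∑<-∑true : ∀ n (f : ℕ → ℕ → ℕ) w →
    ∑< n (λ x → ∑true (f x) w) ≡ ∑true (λ i → ∑< n (λ x → f x i)) w
  ∑<-∑true n f []          = ∑<-zero n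
  ∑<-∑true n f (true ∷ w)  = trans (∑<-+ n (λ x → f x 0) _)
    (cong (∑< n (λ x → f x 0) +_) (∑<-∑true n (λ x → f x ∘ suc) w))
  ∑<-∑true n f (false ∷ w) = ∑<-∑true n (λ x → f x ∘ suc) w

  ∑<-∑flip : ∀ n (f : ℕ → ℕ → List Bool → ℕ) w →
    ∑< n (λ x → ∑flip (f x) w) ≡ ∑flip (λ i u → ∑< n (λ x → f x i u)) w
  ∑<-∑flip n f []          = ∑<-zero n
  ∑<-∑flip n f (true ∷ w)  = ∑<-∑flip n (λ x i u → f x (suc i) (true ∷ u)) w
  ∑<-∑flip n f (false ∷ w) = trans (∑<-+ n (λ x → f x 0 (true ∷ w)) _)
    (cong (∑< n (λ x → f x 0 (true ∷ w)) +_) (∑<-∑flip n (λ x i u → f x (suc i) (false ∷ u)) w))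

  -- Sieving a stream of bits

  _∖_ : (ℕ → Bool) → (ℕ → Bool) → ℕ → Bool
  (c ∖ h) i = c i ∧ not (h i)

  Hit : (c h : ℕ → Bool) → ℕ → Set
  Hit c h i = c i ≡ true × h i ≡ true

  AtMostOneHit : (c h : ℕ → Bool) → ℕ → Set
  AtMostOneHit c h n = ∀ {i j} → i < j → j < n → Hit c h i → Hit c h j → ⊥

  private
    NoHit : (c h : ℕ → Bool) → ℕ → Set
    NoHit c h n = ∀ {i} → i < n → ¬ Hit c h i

    *0 : (h : ℕ → Bool) → ∀ i → ⟦ h i ⟧ * 0 ≡ 0
    *0 h i = *-zeroʳ ⟦ h i ⟧

    occ-∖ : ∀ c h w → NoHit c h (length w) → occ (c ∖ h) w ≡ occ c w
    occ-∖ c h []          none = refl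
    occ-∖ c h (true ∷ w)  none with c 0 in ceq | h 0 in heq
    ... | true  | true  = contradiction (ceq , heq) (none z<s)
    ... | true  | false = occ-∖ (c ∘ suc) (h ∘ suc) w (none ∘ s<s)
    ... | false | _     = refl
    occ-∖ c h (false ∷ w) none with c 0 in ceq | h 0 in heq
    ... | true  | true  = contradiction (ceq , heq) (none z<s)
    ... | true  | false = refl
    ... | false | _     = occ-∖ (c ∘ suc) (h ∘ suc) w (none ∘ s<s)

    -- A non-zero term needs `c` to spell `w`, so `c i` is true at the letter true in position `i`,
    -- and with `h i` this makes a hit. The same argument at the flipped letter gives `∑flip-noHit`.
    ∑true-noHit : ∀ c h w → NoHit c h (length w) → ∑true (λ i → ⟦ h i ⟧ * occ c w) w ≡ 0
    ∑true-noHit c h []          none = refl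
    ∑true-noHit c h (true ∷ w)  none with c 0 in ceq | h 0 in heq
    ... | true  | true  = contradiction (ceq , heq) (none z<s)
    ... | true  | false = ∑true-noHit (c ∘ suc) (h ∘ suc) w (none ∘ s<s)
    ... | false | true  = ∑true-zero (*0 (h ∘ suc)) w
    ... | false | false = ∑true-zero (*0 (h ∘ suc)) w
    ∑true-noHit c h (false ∷ w) none with c 0
    ... | true  = ∑true-zero (*0 (h ∘ suc)) w
    ... | false = ∑true-noHit (c ∘ suc) (h ∘ suc) w (none ∘ s<s)

    ∑flip-noHit : ∀ c h w → NoHit c h (length w) → ∑flip (λ i u → ⟦ h i ⟧ * occ c u) w ≡ 0
    ∑flip-noHit c h []          none = refl
    ∑flip-noHit c h (true ∷ w)  none with c 0
    ... | true  = ∑flip-noHit (c ∘ suc) (h ∘ suc) w (none ∘ s<s)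
    ... | false = ∑flip-zero (λ i _ → *0 (h ∘ suc) i) w
    ∑flip-noHit c h (false ∷ w) none with c 0 in ceq | h 0 in heq
    ... | true  | true  = contradiction (ceq , heq) (none z<s)
    ... | true  | false = ∑flip-zero (λ i _ → *0 (h ∘ suc) i) w
    ... | false | true  = ∑flip-noHit (c ∘ suc) (h ∘ suc) w (none ∘ s<s)
    ... | false | false = ∑flip-noHit (c ∘ suc) (h ∘ suc) w (none ∘ s<s)

  -- With no hit in the window, both correction terms vanish and c ∖ h agrees with
  -- c.  With exactly one hit, at i, the term ∑true equals occ c w, while c ∖ h
  -- spells w iff the letter i of w is false and c spells w flipped there.
  occ-sieve : ∀ c h w → AtMostOneHit c h (length w) →
    occ (c ∖ h) w + ∑true (λ i → ⟦ h i ⟧ * occ c w) w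
      ≡ occ c w + ∑flip (λ i u → ⟦ h i ⟧ * occ c u) w
  occ-sieve c h []          amo = refl
  occ-sieve c h (true ∷ w)  amo with c 0 in ceq | h 0 in heq
  ... | true  | true  = cong₂ _+_ (+-identityʳ (occ (c ∘ suc) w))
    (trans (∑true-noHit (c ∘ suc) (h ∘ suc) w none) (sym (∑flip-noHit (c ∘ suc) (h ∘ suc) w none)))
    where
    none : NoHit (c ∘ suc) (h ∘ suc) (length w)
    none i<n = amo z<s (s<s i<n) (ceq , heq)
  ... | true  | false =
    occ-sieve (c ∘ suc) (h ∘ suc) w (λ i<j j<n → amo (s<s i<j) (s<s j<n))
  ... | false | true  = trans (∑true-zero (*0 (h ∘ suc)) w)
    (sym (∑flip-zero (λ i _ → *0 (h ∘ suc) i) w))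
  ... | false | false = trans (∑true-zero (*0 (h ∘ suc)) w)
    (sym (∑flip-zero (λ i _ → *0 (h ∘ suc) i) w))
  occ-sieve c h (false ∷ w) amo with c 0 in ceq | h 0 in heq
  ... | true  | true  = cong₂ _+_
    (trans (occ-∖ (c ∘ suc) (h ∘ suc) w none) (sym (+-identityʳ _)))
    (trans (∑true-zero (*0 (h ∘ suc)) w) (sym (∑flip-zero (λ i _ → *0 (h ∘ suc) i) w)))
    where
    none : NoHit (c ∘ suc) (h ∘ suc) (length w)
    none i<n = amo z<s (s<s i<n) (ceq , heq)
  ... | true  | false = trans (∑true-zero (*0 (h ∘ suc)) w)
    (sym (∑flip-zero (λ i _ → *0 (h ∘ suc) i) w))
  ... | false | true  = occ-sieve (c ∘ suc) (h ∘ suc) w (λ i<j j<n → amo (s<s i<j) (s<s j<n))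
  ... | false | false = occ-sieve (c ∘ suc) (h ∘ suc) w (λ i<j j<n → amo (s<s i<j) (s<s j<n))

  -- The sieve of Eratosthenes modulo Π k

  unit : ℕ → ℕ → Bool
  unit k x = does (coprime? x (Π k))

  -- Windows may run past `Π k`; as `unit k` has period `Π k`, this is the cyclic count.
  count : ℕ → List Bool → ℕ
  count k w = ∑< (Π k) (λ x → occ (λ i → unit k (x + i)) w)

  does-cong : ∀ {A B : Set} (a? : Dec A) (b? : Dec B) → (A → B) → (B → A) → does a? ≡ does b?
  does-cong (yes a) b? f h = sym (dec-true b? (f a))
  does-cong (no ¬a) b? f h = sym (dec-false b? (¬a ∘ h))

  does⇒ : ∀ {A : Set} (a? : Dec A) → does a? ≡ true → A
  does⇒ (yes a) _ = a

  unit-period : ∀ k t x → unit k (t * Π k + x) ≡ unit k x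
  unit-period k t x = does-cong (coprime? (t * Π k + x) (Π k)) (coprime? x (Π k))
    (λ co {d} (d∣x , d∣Π) → co (∣m∣n⇒∣m+n (∣n⇒∣m*n t d∣Π) d∣x , d∣Π))
    (λ co {d} (d∣s , d∣Π) → co (∣m+n∣m⇒∣n {d} {t * Π k} {x} d∣s (∣n⇒∣m*n t d∣Π) , d∣Π))

  p-prime : ∀ k → Prime (p (suc k))
  p-prime k = NextPrime.isPrime (nextPrime (p k))

  p<p : ∀ k → p k < p (suc k)
  p<p k = NextPrime.above (nextPrime (p k))

  -- Taking any prime `r` above `p k` lets the induction descend: by Euclid's lemma `r` divides
  -- either the last factor, which is smaller than `r`, or the product of the earlier ones.
  prime∤Π : ∀ k {r} → Prime r → p k < r → ¬ r ∣ Π k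
  prime∤Π zero    pr _  r∣1 = contradiction (subst Prime (∣1⇒≡1 r∣1) pr) ¬prime[1]
  prime∤Π (suc k) pr lt r∣ with euclidsLemma (Π k) (p (suc k)) pr r∣
  ... | inj₁ r∣Π = prime∤Π k pr (<-trans (p<p k) lt) r∣Π
  ... | inj₂ r∣p = contradiction (∣⇒≤ {{>-nonZero (p-positive (suc k))}} r∣p) (<⇒≱ lt)

  prime∤⇒coprime : ∀ {q} m → Prime q → ¬ q ∣ m → Coprime m q
  prime∤⇒coprime m pq q∤m (d∣m , d∣q) with prime⇒irreducible pq d∣q
  ... | inj₁ d≡1  = d≡1
  ... | inj₂ refl = contradiction d∣m q∤m

  coprime-p : ∀ k → Coprime (Π k) (p (suc k))
  coprime-p k = prime∤⇒coprime (Π k) (p-prime k) (prime∤Π k (p-prime k) (p<p k))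

  hit : ℕ → ℕ → Bool
  hit k x = does (p (suc k) ∣? x)

  unit-suc : ∀ k x → unit (suc k) x ≡ unit k x ∧ not (hit k x)
  unit-suc k x = does-cong (coprime? x (Π (suc k)))
    -- The `does` of this decision computes to `unit k x ∧ not (hit k x)`.
    (coprime? x (Π k) ×-dec ¬? (q ∣? x))
    (λ co → (λ (d∣x , d∣Π) → co (d∣x , ∣m⇒∣m*n q d∣Π)) ,
       λ q∣x → ¬prime[1] (subst Prime (co (q∣x , ∣n⇒∣m*n (Π k) ∣-refl)) (p-prime k)))
    -- As `q` does not divide `x`, a common divisor `d` of `x` and `Π k * q` is coprime to `q`,
    -- hence divides `Π k`.
    (λ (co , q∤x) {d} (d∣x , d∣Πq) → co (d∣x ,
       coprime-divisor {o = Π k}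
         (λ (e∣d , e∣q) → prime∤⇒coprime x (p-prime k) q∤x (∣-trans e∣d d∣x , e∣q))
         (subst (d ∣_) (*-comm (Π k) q) d∣Πq)))
    where q = p (suc k)

  -- Multiples of `q` along arithmetic progressions of step `M`.

  module _ {q : ℕ} {{_ : NonZero q}} (M : ℕ) (co : Coprime M q) where

    private
      solution : ∀ y → ∃[ t ] q ∣ y + t * M
      solution y with coprime-Bézout co
      ... | Bézout.-+ a b eq = y * a , divides (y * b) (begin
        y + y * a * M     ≡⟨ lem y a M ⟩
        y * (1 + a * M)   ≡⟨ cong (y *_) eq ⟩
        y * (b * q)       ≡⟨ *-assoc y b q ⟨
        y * b * q         ∎)
        where
        lem : ∀ y a M → y + y * a * M ≡ y * (1 + a * M)
        lem = solve-∀
      -- Here `a` inverts `M` modulo `q`, and `pred q` stands for -1 in the solution -y·a.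
      ... | Bézout.+- a b eq = y * pred q * a , divides (y + y * pred q * b) (begin
        y + y * pred q * a * M          ≡⟨ cong (y +_) (*-assoc (y * pred q) a M) ⟩
        y + y * pred q * (a * M)        ≡⟨ cong (λ z → y + y * pred q * z) eq ⟨
        y + y * pred q * (1 + b * q)    ≡⟨ lem y (pred q) b q ⟩
        y * suc (pred q) + y * pred q * b * q ≡⟨ cong (λ z → y * z + y * pred q * b * q) (suc-pred q) ⟩
        y * q + y * pred q * b * q      ≡⟨ *-distribʳ-+ q y (y * pred q * b) ⟨
        (y + y * pred q * b) * q        ∎)
        where
        lem : ∀ y r b q → y + y * r * (1 + b * q) ≡ y * suc r + y * r * b * q
        lem = solve-∀

      distance : ∀ y s t → s ≤ t → q ∣ y + s * M → q ∣ y + t * M → q ∣ t ∸ s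
      distance y s t s≤t q∣s q∣t = coprime-divisor {o = t ∸ s} (λ (d∣q , d∣M) → co (d∣M , d∣q))
        (∣m+n∣m⇒∣n (subst (q ∣_) (begin
          y + t * M                 ≡⟨ cong (λ z → y + z * M) (m+[n∸m]≡n s≤t) ⟨
          y + (s + (t ∸ s)) * M     ≡⟨ lem y s (t ∸ s) M ⟩
          y + s * M + M * (t ∸ s)   ∎) q∣t) q∣s)
        where
        lem : ∀ y s d M → y + (s + d) * M ≡ y + s * M + M * d
        lem = solve-∀

      ≤-solution : ∀ y s t → t < q → s ≤ t → q ∣ y + s * M → q ∣ y + t * M → s ≡ t
      ≤-solution y s t t<q s≤t q∣s q∣t with t ∸ s in eq
                                          | distance y s t s≤t q∣s q∣t
      ... | zero  | _   = ≤-antisym s≤t (m∸n≡0⇒m≤n eq)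
      ... | suc d | q∣d = contradiction (∣⇒≤ q∣d)
        (<⇒≱ (≤-<-trans (≤-trans (≤-reflexive (sym eq)) (m∸n≤m t s)) t<q))

    -- `M` is invertible modulo `q`, so the congruence has one solution modulo `q`; Bézout's
    -- solution is reduced modulo `q` to lie in the range.
    solutions≡1 : ∀ y → ∑< q (λ t → ⟦ does (q ∣? y + t * M) ⟧) ≡ 1
    solutions≡1 y with solution y
    ... | t , q∣t = ∑<-unique q _ (m%n<n t q) (dec-true (q ∣? _) q∣r) uniq
      where
      q∣r : q ∣ y + t % q * M
      q∣r = ∣m+n∣m⇒∣n (subst (q ∣_) (begin
        y + t * M                          ≡⟨ cong (λ z → y + z * M) (m≡m%n+[m/n]*n t q) ⟩
        y + (t % q + t / q * q) * M        ≡⟨ lem y (t % q) (t / q) q M ⟩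
        t / q * M * q + (y + t % q * M)    ∎) q∣t) (n∣m*n (t / q * M))
        where
        lem : ∀ y r d q M → y + (r + d * q) * M ≡ d * M * q + (y + r * M)
        lem = solve-∀
      uniq : ∀ j → j < q → does (q ∣? y + j * M) ≡ true → j ≡ t % q
      uniq j j<q eq with ≤-total j (t % q)
      ... | inj₁ j≤ = ≤-solution y j (t % q) (m%n<n t q) j≤ (does⇒ (q ∣? _) eq) q∣r
      ... | inj₂ ≤j = sym (≤-solution y (t % q) j j<q ≤j q∣r (does⇒ (q ∣? _) eq))

    module _ (f : ℕ → ℕ) (periodic : ∀ t x → f (t * M + x) ≡ f x) where

      ∑<-periods : ∑< (q * M) f ≡ q * ∑< M f
      ∑<-periods = trans (∑<-blocks q M f)
        (trans (∑<-cong q λ t → ∑<-cong M (periodic t)) (∑<-const q (∑< M f)))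

      -- Cut the range into `q` blocks of length `M` and sum over blocks first: for fixed `x` the
      -- value `f x` is the same in every block, and exactly one block makes the shifted position a
      -- multiple of `q`.
      ∑<-hits : ∀ i → ∑< (q * M) (λ x → ⟦ does (q ∣? x + i) ⟧ * f x) ≡ ∑< M f
      ∑<-hits i = begin
        ∑< (q * M) (λ x → ⟦ does (q ∣? x + i) ⟧ * f x)
          ≡⟨ ∑<-blocks q M _ ⟩
        ∑< q (λ t → ∑< M (λ x → ⟦ does (q ∣? t * M + x + i) ⟧ * f (t * M + x)))
          ≡⟨ ∑<-cong q (λ t → ∑<-cong M λ x → cong₂ (λ y z → ⟦ does (q ∣? y) ⟧ * z)
               (trans (+-assoc (t * M) x i) (+-comm (t * M) (x + i))) (periodic t x)) ⟩
        ∑< q (λ t → ∑< M (λ x → ⟦ does (q ∣? x + i + t * M) ⟧ * f x))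
          ≡⟨ ∑<-swap q M _ ⟩
        ∑< M (λ x → ∑< q (λ t → ⟦ does (q ∣? x + i + t * M) ⟧ * f x))
          ≡⟨ ∑<-cong M (λ x → trans (∑<-*ʳ q _ (f x))
               (trans (cong (_* f x) (solutions≡1 (x + i))) (*-identityˡ (f x)))) ⟩
        ∑< M f ∎

  -- The recurrence for cyclic word counts.

  occ-period : ∀ k w t x → occ (λ i → unit k (t * Π k + x + i)) w ≡ occ (λ i → unit k (x + i)) w
  occ-period k w t x = occ-cong (λ i →
    trans (cong (unit k) (+-assoc (t * Π k) x i)) (unit-period k t (x + i))) w

  -- This is `occ-sieve` summed over `q` periods. The term free of hits gains a factor `q`, while
  -- each term weighted by a hit at a fixed position collapses to a single period by `∑<-hits`.
  count-suc : ∀ k w →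
    (∀ x → AtMostOneHit (λ i → unit k (x + i)) (λ i → hit k (x + i)) (length w)) →
    count (suc k) w + ∑true (λ _ → count k w) w ≡ p (suc k) * count k w + ∑flip (λ _ u → count k u) w
  count-suc k w amo = begin
    count (suc k) w + ∑true (λ _ → count k w) w
      ≡⟨ cong₂ _+_
           (trans
             (cong (λ m → ∑< m (λ x → occ (λ i → unit (suc k) (x + i)) w)) (*-comm (Π k) q))
             (∑<-cong n λ x → occ-cong (λ i → unit-suc k (x + i)) w))
           (trans
             (∑true-cong (λ i → sym (hits w i)) w)
             (sym (∑<-∑true n _ w))) ⟩
    ∑< n (λ x → occ (c x ∖ h x) w) + ∑< n (λ x → ∑true (λ i → ⟦ h x i ⟧ * occ (c x) w) w)
      ≡⟨ ∑<-+ n _ _ ⟨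
    ∑< n (λ x → occ (c x ∖ h x) w + ∑true (λ i → ⟦ h x i ⟧ * occ (c x) w) w)
      ≡⟨ ∑<-cong n (λ x → occ-sieve (c x) (h x) w (amo x)) ⟩
    ∑< n (λ x → occ (c x) w + ∑flip (λ i u → ⟦ h x i ⟧ * occ (c x) u) w)
      ≡⟨ ∑<-+ n _ _ ⟩
    ∑< n (λ x → occ (c x) w) + ∑< n (λ x → ∑flip (λ i u → ⟦ h x i ⟧ * occ (c x) u) w)
      ≡⟨ cong₂ _+_ (∑<-periods (Π k) (coprime-p k) (λ x → occ (c x) w) (occ-period k w))
           (trans (∑<-∑flip n _ w)
             (∑flip-cong (λ i u → hits u i) w)) ⟩
    q * count k w + ∑flip (λ _ u → count k u) w ∎
    where
    q = p (suc k)
    n = q * Π k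
    c h : ℕ → ℕ → Bool
    c x i = unit k (x + i)
    h x i = hit k (x + i)
    instance _ = >-nonZero (p-positive (suc k))
    hits : ∀ u i → ∑< n (λ x → ⟦ h x i ⟧ * occ (c x) u) ≡ count k u
    hits u = ∑<-hits (Π k) (coprime-p k) (λ x → occ (c x) u) (occ-period k u)

  2∣Π : ∀ k → 1 ≤ k → 2 ∣ Π k
  2∣Π (suc zero)        _ = subst (2 ∣_) (sym (trans (*-identityˡ (p 1)) p1≡2)) ∣-refl
    where
    p1≡2 : p 1 ≡ 2
    p1≡2 = ≤-antisym (NextPrime.least (nextPrime 1) 2 ≤-refl prime[2]) (p<p 0)
  2∣Π (suc (suc k))     _ = ∣m⇒∣m*n (p (suc (suc k))) (2∣Π (suc k) (s≤s z≤n))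

  even⊎even-suc : ∀ n → 2 ∣ n ⊎ 2 ∣ suc n
  even⊎even-suc zero    = inj₁ (2 ∣0)
  even⊎even-suc (suc n) with even⊎even-suc n
  ... | inj₁ 2∣n  = inj₂ (∣m∣n⇒∣m+n (∣-refl {2}) 2∣n)
  ... | inj₂ 2∣sn = inj₁ 2∣sn

  -- Two hits in a window of length 2q would lie at distance q, which is odd, so
  -- that one of them would be even; but 2 divides Π k.
  atMostOneHit : ∀ k → 1 ≤ k → ∀ {n} → n ≤ 2 * p (suc k) → ∀ x →
    AtMostOneHit (λ i → unit k (x + i)) (λ i → hit k (x + i)) n
  atMostOneHit k 1≤k {n} n≤2q x {i} {j} i<j j<n (ci , hi) (cj , hj) =
    absurd (even⊎even-suc (x + i)) (even⊎even-suc q)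
    where
    q = p (suc k)
    q∣d : q ∣ j ∸ i
    q∣d = ∣m+n∣m⇒∣n (subst (q ∣_)
      (trans (cong (x +_) (sym (m+[n∸m]≡n (<⇒≤ i<j)))) (sym (+-assoc x i (j ∸ i))))
      (does⇒ (q ∣? _) hj)) (does⇒ (q ∣? _) hi)
    d≡q : j ∸ i ≡ q
    d≡q with q∣d
    ... | divides zero          eq = contradiction (sym eq) (<⇒≢ (m<n⇒0<n∸m i<j))
    ... | divides (suc zero)    eq = trans eq (+-identityʳ q)
    -- A quotient of at least 2 would force `2 * q ≤ j`, but `j < n ≤ 2 * q`.
    ... | divides (suc (suc m)) eq = contradiction
      (≤-trans (*-monoˡ-≤ q (s≤s (s≤s (z≤n {m})))) (≤-trans (≤-reflexive (sym eq)) (m∸n≤m j i)))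
      (<⇒≱ (<-≤-trans j<n n≤2q))
    odd : ∀ y → unit k y ≡ true → ¬ 2 ∣ y
    odd y cy 2∣y with () ← does⇒ (coprime? y (Π k)) cy (2∣y , 2∣Π k 1≤k)
    x+j : x + j ≡ x + i + q
    x+j = trans (cong (x +_) (trans (sym (m+[n∸m]≡n (<⇒≤ i<j))) (cong (i +_) d≡q))) (sym (+-assoc x i q))
    absurd : 2 ∣ x + i ⊎ 2 ∣ suc (x + i) → 2 ∣ q ⊎ 2 ∣ suc q → ⊥
    absurd (inj₁ 2∣a)  _ = odd (x + i) ci 2∣a
    absurd (inj₂ _)    (inj₁ 2∣q) with () ← coprime-p k (2∣Π k 1≤k , 2∣q)
    -- The even numbers `suc (x + i)` and `suc q` add up to `2 + (x + j)`.
    absurd (inj₂ 2∣sa) (inj₂ 2∣sq) = odd (x + j) cj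
      (∣m+n∣m⇒∣n (subst (2 ∣_) (cong suc (trans (+-suc (x + i) q) (cong suc (sym x+j))))
        (∣m∣n⇒∣m+n 2∣sa 2∣sq)) ∣-refl)

  -- A window of length 1 holds no two hits, and the word has one letter true and none to flip, so
  -- `count-suc` becomes the recursion of `Φ`.
  count-unit : ∀ k → count k (true ∷ []) ≡ Φ k
  count-unit zero    = refl
  count-unit (suc k) = +-cancelʳ-≡ (count k (true ∷ [])) _ _ (begin
    count (suc k) w + count k w          ≡⟨ cong (count (suc k) w +_) (+-identityʳ (count k w)) ⟨
    count (suc k) w + (count k w + 0)    ≡⟨ count-suc k w (λ { x (s≤s _) (s≤s ()) }) ⟩
    p (suc k) * count k w + 0        ≡⟨ +-identityʳ _ ⟩
    p (suc k) * count k w            ≡⟨ cong (λ n → n * count k w) (suc-pred (p (suc k))) ⟨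
    count k w + (p (suc k) ∸ 1) * count k w    ≡⟨ +-comm (count k w) _ ⟩
    (p (suc k) ∸ 1) * count k w + count k w    ≡⟨ cong (_+ count k w) (*-comm (p (suc k) ∸ 1) (count k w)) ⟩
    count k w * (p (suc k) ∸ 1) + count k w    ≡⟨ cong (λ n → n * (p (suc k) ∸ 1) + count k w) (count-unit k) ⟩
    Φ k * (p (suc k) ∸ 1) + count k w      ∎)
    where
    w = true ∷ []
    instance _ = >-nonZero (p-positive (suc k))

  -- Gaps

  First : (ℕ → Bool) → ℕ → Set
  First c d = c d ≡ true × (∀ {i} → i < d → c i ≡ false)

  -- The next true bit is sought in the shifted stream, so a gap `suc d` has `d` zeros inside,
  -- matching the `pred a` zeros in `rest`.
  Gap : (ℕ → Bool) → ℕ → Set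
  Gap c zero    = ⊥
  Gap c (suc d) = c 0 ≡ true × First (c ∘ suc) d

  GapAt : (ℕ → Bool) → ℕ → ℕ → Set
  GapAt c x d = Gap (λ i → c (x + i)) d

  gap-start : ∀ {c} a → Gap c a → c 0 ≡ true
  gap-start (suc a) (c0 , _) = c0

  Gap-cong : ∀ {c d : ℕ → Bool} → (∀ i → c i ≡ d i) → ∀ a → Gap c a → Gap d a
  Gap-cong eq (suc a) (c0 , ca , c<) =
    trans (sym (eq 0)) c0 , trans (sym (eq _)) ca , λ i<a → trans (sym (eq _)) (c< i<a)

  -- word s is the pattern of units along an occurrence of s: a letter true for
  -- each end of a gap.
  rest word : ∀ {j} → Vec ℕ j → List Bool
  rest []       = []
  rest (a ∷ as) = replicate (pred a) false ++ word as
  word s = true ∷ rest s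

  occ-first : ∀ {c d} → First c d → ∀ w →
    occ c (replicate d false ++ true ∷ w) ≡ occ (λ i → c (d + i)) (true ∷ w)
  occ-first {d = zero}  _         w = refl
  occ-first {d = suc d} (cd , c<) w rewrite c< z<s = occ-first (cd , c< ∘ s<s) w

  -- Too few zeros put the letter true on a false bit; too many put a letter false on the true bit
  -- at `d`.
  occ-¬first : ∀ {c d} → First c d → ∀ n → n ≢ d → ∀ w →
    occ c (replicate n false ++ true ∷ w) ≡ 0
  occ-¬first {d = zero}  _         zero    n≢d w = contradiction refl n≢d
  occ-¬first {d = zero}  (cd , _)  (suc n) n≢d w rewrite cd = refl
  occ-¬first {d = suc d} (_ , c<)  zero    n≢d w rewrite c< z<s = refl
  occ-¬first {d = suc d} (cd , c<) (suc n) n≢d w rewrite c< z<s =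
    occ-¬first (cd , c< ∘ s<s) n (n≢d ∘ cong suc) w

  occ-gap : ∀ {c} a → Gap c a → ∀ {j} (as : Vec ℕ j) →
    occ c (word (a ∷ as)) ≡ occ (λ i → c (a + i)) (word as)
  occ-gap (suc a) (c0 , first) as rewrite c0 = occ-first first (rest as)

  -- Positivity of `a` matters: since `pred 0` is `pred 1`, an entry 0 has the same word as an entry
  -- 1.
  occ-¬gap : ∀ {c} d → Gap c d → ∀ {a} → 0 < a → a ≢ d → ∀ {j} (as : Vec ℕ j) →
    occ c (word (a ∷ as)) ≡ 0
  occ-¬gap (suc d) (c0 , first) {suc a} _ a≢d as rewrite c0 =
    occ-¬first first a (a≢d ∘ cong suc) (rest as)

  -- The bridge between lists of differences and bit streams: the gaps, laid end to end from `x`,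
  -- reach `y`, and each joint is a true bit with none in between.
  data Tiles (c : ℕ → Bool) : ℕ → List ℕ → ℕ → Set where
    []  : ∀ {x} → Tiles c x [] x
    _∷_ : ∀ {x d ds y} → GapAt c x d → Tiles c (x + d) ds y → Tiles c x (d ∷ ds) y

  module _ {P : ℕ → Set} (P? : Decidable P) where

    private
      c : ℕ → Bool
      c x = does (P? x)

    -- The pending entry x has been followed by e numbers that do not satisfy P.
    tiles-differences : ∀ m e {x y} (h : ℕ → ℕ) → (∀ i → h i ≡ x + suc (e + i)) →
      c x ≡ true → (∀ {i} → i < e → c (x + suc i) ≡ false) →
      y ≡ x + (e + m) → c y ≡ true →
      Tiles c x (differences (x ∷ filter P? (applyUpTo h m))) y
    tiles-differences zero zero {x} h eq cx c< refl cy =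
      subst (Tiles c x []) (sym (+-identityʳ x)) []
    -- With the list exhausted, `y` is the last rejected number, contradicting `c y ≡ true`.
    tiles-differences zero (suc e) {x} h eq cx c< refl cy
      with () ← trans (sym cy) (trans (cong (λ z → c (x + suc z)) (+-identityʳ e)) (c< ≤-refl))
    tiles-differences (suc m) e {x} {y} h eq cx c< y≡ cy
      with does (P? (h 0)) in ceq
    ... | false = tiles-differences m (suc e) (h ∘ suc)
      (λ i → trans (eq (suc i)) (cong (λ z → x + suc z) (+-suc e i))) cx c<′
      (trans y≡ (cong (x +_) (+-suc e m))) cy
      where
      c<′ : ∀ {i} → i < suc e → c (x + suc i) ≡ false
      c<′ {i} i<1+e with m≤n⇒m<n∨m≡n (s≤s⁻¹ i<1+e)
      ... | inj₁ i<e  = c< i<e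
      ... | inj₂ refl = trans (cong c (sym (trans (eq 0) (cong (λ z → x + suc z) (+-identityʳ i))))) ceq
    ... | true = subst (λ z → Tiles c x (z ∸ x ∷ differences (z ∷ zs)) y) (sym h0)
      (subst (λ d → Tiles c x (d ∷ differences (x + suc e ∷ zs)) y) (sym (m+n∸m≡n x (suc e)))
        ((trans (cong c (+-identityʳ x)) cx , trans (cong c (sym h0)) ceq , c<)
          ∷ tiles-differences m 0 (h ∘ suc)
            (λ i → trans (eq (suc i)) (lem x e i))
            (trans (cong c (sym h0)) ceq) (λ ()) (trans y≡ (lem′ x e m)) cy))
      where
      zs = filter P? (applyUpTo (h ∘ suc) m)
      h0 : h 0 ≡ x + suc e
      h0 = trans (eq 0) (cong (λ z → x + suc z) (+-identityʳ e))
      lem : ∀ x e i → x + suc (e + suc i) ≡ x + suc e + suc i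
      lem = solve-∀
      lem′ : ∀ x e m → x + (e + suc m) ≡ x + suc e + m
      lem′ = solve-∀

  module _ {c : ℕ → Bool} where

    tiles-end : ∀ {x y} (f : ℕ → ℕ) n → Tiles c x (applyUpTo f n) y → y ≡ x + ∑< n f
    tiles-end {x} f zero    []       = sym (+-identityʳ x)
    tiles-end {x} f (suc n) (_ ∷ ts) = trans (tiles-end (f ∘ suc) n ts) (+-assoc x (f 0) _)

    tiles-gap : ∀ {x y} (f : ℕ → ℕ) n → Tiles c x (applyUpTo f n) y →
      ∀ {i} → i < n → GapAt c (x + ∑< i f) (f i)
    tiles-gap {x} f (suc n) (gap ∷ ts) {zero}  _         =
      subst (λ z → GapAt c z (f 0)) (sym (+-identityʳ x)) gap
    tiles-gap {x} f (suc n) (gap ∷ ts) {suc i} (s<s i<n) =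
      subst (λ z → GapAt c z (f (suc i))) (+-assoc x (f 0) _) (tiles-gap (f ∘ suc) n ts i<n)

    ∑<-gap : ∀ {x} d → GapAt c x d → (F : ℕ → ℕ) → ∑< d (λ z → ⟦ c (x + z) ⟧ * F (x + z)) ≡ F x
    ∑<-gap {x} (suc d) (c0 , _ , c<) F = begin
      ⟦ c (x + 0) ⟧ * F (x + 0) + _
        ≡⟨ cong₂ _+_ (cong (λ b → ⟦ b ⟧ * F (x + 0)) c0)
             (∑<-vanish d λ {i} i<d → cong (λ b → ⟦ b ⟧ * F (x + suc i)) (c< i<d)) ⟩
      1 * F (x + 0) + 0
        ≡⟨ trans (+-identityʳ _) (*-identityˡ _) ⟩
      F (x + 0)
        ≡⟨ cong F (+-identityʳ x) ⟩
      F x ∎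

    -- Each tile contains exactly one true bit, its left end, so summing over tiles is summing over
    -- true bits.
    ∑<-tiles : ∀ {x y} (f : ℕ → ℕ) n → Tiles c x (applyUpTo f n) y → (F : ℕ → ℕ) →
      ∑< n (λ i → F (x + ∑< i f)) ≡ ∑< (∑< n f) (λ z → ⟦ c (x + z) ⟧ * F (x + z))
    ∑<-tiles {x} f zero    []         F = refl
    ∑<-tiles {x} f (suc n) (gap ∷ ts) F = begin
      F (x + 0) + ∑< n (λ i → F (x + (f 0 + ∑< i (f ∘ suc))))
        ≡⟨ cong₂ _+_ (trans (cong F (+-identityʳ x)) (sym (∑<-gap (f 0) gap F)))
             (trans (∑<-cong n (λ i → cong F (sym (+-assoc x (f 0) _))))
               (∑<-tiles (f ∘ suc) n ts F)) ⟩
      ∑< (f 0) G + ∑< (∑< n (f ∘ suc)) (λ z → ⟦ c (x + f 0 + z) ⟧ * F (x + f 0 + z))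
        ≡⟨ cong (∑< (f 0) G +_) (∑<-cong (∑< n (f ∘ suc)) λ z →
             cong (λ y → ⟦ c y ⟧ * F y) (+-assoc x (f 0) z)) ⟩
      ∑< (f 0) G + ∑< (∑< n (f ∘ suc)) (λ z → G (f 0 + z))
        ≡⟨ ∑<-++ (f 0) _ G ⟨
      ∑< (f 0 + ∑< n (f ∘ suc)) G ∎
      where
      G : ℕ → ℕ
      G z = ⟦ c (x + z) ⟧ * F (x + z)

    -- The stream at the `n`-th joint opens with the gap `f n`, so the first entry must equal it,
    -- and then both sides move on to the next joint. The decision is arbitrary so that the
    -- induction can pass from `occurs?` to `tail?`.
    occ-occurs : ∀ (f : ℕ → ℕ) x → (∀ n → GapAt c (x + ∑< n f) (f n)) →
      ∀ {j} (s : Vec ℕ j) → All (0 <_) s → ∀ n →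
      (occurs? : Dec (∀ l → f (n + toℕ l) ≡ lookup s l)) →
      ⟦ does occurs? ⟧ ≡ occ (λ i → c (x + ∑< n f + i)) (word s)
    occ-occurs f x gaps [] [] n occurs?
      rewrite dec-true occurs? (λ ()) | gap-start (f n) (gaps n) = refl
    occ-occurs f x gaps (a ∷ as) (0<a ∷ pos) n occurs? with f n ≟ a
    ... | no fn≢a = trans
      (cong ⟦_⟧ (dec-false occurs? λ occurs → fn≢a (trans (cong f (sym (+-identityʳ n))) (occurs Fin.zero))))
      (sym (occ-¬gap (f n) (gaps n) 0<a (fn≢a ∘ sym) as))
    ... | yes refl = begin
      ⟦ does occurs? ⟧
        ≡⟨ cong ⟦_⟧ (does-cong occurs? tail?
             (λ occurs l → trans (cong f (sym (+-suc n (toℕ l)))) (occurs (Fin.suc l)))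
             (λ { _ Fin.zero → cong f (+-identityʳ n)
                ; occurs (Fin.suc l) → trans (cong f (+-suc n (toℕ l))) (occurs l) })) ⟩
      ⟦ does tail? ⟧
        ≡⟨ occ-occurs f x gaps as pos (suc n) tail? ⟩
      occ (λ i → c (x + ∑< (suc n) f + i)) (word as)
        ≡⟨ occ-cong (λ i → cong c (begin
             x + ∑< (suc n) f + i      ≡⟨ cong (λ y → x + y + i) (∑<-suc n f) ⟩
             x + (∑< n f + f n) + i    ≡⟨ cong (_+ i) (+-assoc x (∑< n f) (f n)) ⟨
             x + ∑< n f + f n + i      ≡⟨ +-assoc (x + ∑< n f) (f n) i ⟩
             x + ∑< n f + (f n + i)    ∎)) (word as) ⟩
      occ (λ i → c (x + ∑< n f + (f n + i))) (word as)
        ≡⟨ occ-gap (f n) (gaps n) as ⟨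
      occ (λ i → c (x + ∑< n f + i)) (word (f n ∷ as)) ∎
      where
      tail? = all? λ l → f (suc n + toℕ l) ≟ lookup as l

  -- Mirrors the lookup in `g`, so that `g k (suc n)` unfolds to `nth (𝒢 k) (n % Φ k)`.
  nth : List ℕ → ℕ → ℕ
  nth ds n = fromMaybe 0 (head (drop n ds))

  applyUpTo-nth : ∀ ds → applyUpTo (nth ds) (length ds) ≡ ds
  applyUpTo-nth []       = refl
  applyUpTo-nth (d ∷ ds) = cong (d ∷_) (applyUpTo-nth ds)

  applyUpTo-cong : ∀ n {f h : ℕ → ℕ} → (∀ {i} → i < n → f i ≡ h i) → applyUpTo f n ≡ applyUpTo h n
  applyUpTo-cong zero    eq = refl
  applyUpTo-cong (suc n) eq = cong₂ _∷_ (eq z<s) (applyUpTo-cong n (eq ∘ s<s))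

  length-filter-applyUpTo : ∀ {P : ℕ → Set} (P? : Decidable P) (h : ℕ → ℕ) n →
    length (filter P? (applyUpTo h n)) ≡ ∑< n (λ i → ⟦ does (P? (h i)) ⟧)
  length-filter-applyUpTo P? h zero    = refl
  length-filter-applyUpTo P? h (suc n) with does (P? (h 0))
  ... | true  = cong suc (length-filter-applyUpTo P? (h ∘ suc) n)
  ... | false = length-filter-applyUpTo P? (h ∘ suc) n

  -- Flipped words as words of split constellations.

  ∑flip-zeros : ∀ n w (F : List Bool → ℕ) →
    ∑flip (λ _ → F) (replicate n false ++ w)
      ≡ ∑< n (λ b → F (replicate b false ++ true ∷ replicate (n ∸ suc b) false ++ w))
        + ∑flip (λ _ u → F (replicate n false ++ u)) w
  ∑flip-zeros zero    w F = refl
  ∑flip-zeros (suc n) w F = trans (cong (F _ +_) (∑flip-zeros n w (F ∘ (false ∷_))))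
    (sym (+-assoc (F (true ∷ replicate n false ++ w)) _ _))

  -- Flipping zero number `b` inside the first gap `a` cuts it into `suc b` and `a ∸ suc b`, which
  -- is `splitHead`; flips further right split the tail.
  ∑flip-rest : ∀ {j} (s : Vec ℕ j) (F : List Bool → ℕ) →
    ∑flip (λ _ → F) (rest s) ≡ sum (map (F ∘ rest) (splits s))
  ∑flip-rest []       F = refl
  ∑flip-rest (a ∷ as) F = begin
    ∑flip (λ _ → F) (replicate (pred a) false ++ word as)
      ≡⟨ ∑flip-zeros (pred a) (word as) F ⟩
    ∑< (pred a) (λ b → F (replicate b false ++ true ∷ replicate (pred a ∸ suc b) false ++ word as))
      + ∑flip (λ _ u → F (replicate (pred a) false ++ true ∷ u)) (rest as)
      ≡⟨ cong₂ _+_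
           (trans
             (∑<-cong (pred a) λ b →
               cong (λ m → F (replicate b false ++ true ∷ replicate m false ++ word as)) (lem a b))
             (cong sum (trans (sym (map-upTo (F ∘ rest ∘ splitHead a as) (pred a))) (map-∘ (upTo (pred a))))))
           (trans (∑flip-rest as (λ u → F (replicate (pred a) false ++ true ∷ u)))
             (cong sum (map-∘ (splits as)))) ⟩
    sum (map (F ∘ rest) (map (splitHead a as) (upTo (pred a)))) + sum (map (F ∘ rest) (map (a ∷_) (splits as)))
      ≡⟨ sum-++ (map (F ∘ rest) (map (splitHead a as) (upTo (pred a)))) _ ⟨
    sum (map (F ∘ rest) (map (splitHead a as) (upTo (pred a))) ++ map (F ∘ rest) (map (a ∷_) (splits as)))
      ≡⟨ cong sum (map-++ (F ∘ rest) (map (splitHead a as) (upTo (pred a))) _) ⟨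
    sum (map (F ∘ rest) (splits (a ∷ as))) ∎
    where
    lem : ∀ a b → pred a ∸ suc b ≡ pred (a ∸ suc b)
    lem zero    b = refl
    lem (suc a) b = sym (pred[m∸n]≡m∸[1+n] a b)

  ∑flip-word : ∀ {j} (s : Vec ℕ j) (F : List Bool → ℕ) →
    ∑flip (λ _ → F) (word s) ≡ sum (map (F ∘ word) (splits s))
  ∑flip-word s F = ∑flip-rest s (F ∘ (true ∷_))

  ∑true-zeros : ∀ n w a → ∑true (λ _ → a) (replicate n false ++ w) ≡ ∑true (λ _ → a) w
  ∑true-zeros zero    w a = refl
  ∑true-zeros (suc n) w a = ∑true-zeros n w a

  -- The letters true are the `j + 1` ends of the `j` gaps; the coefficient j + 1 of the theorem
  -- originates here.
  ∑true-word : ∀ {j} (s : Vec ℕ j) a → ∑true (λ _ → a) (word s) ≡ suc j * a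
  ∑true-word []       a = refl
  ∑true-word (b ∷ as) a = cong (a +_) (trans (∑true-zeros (pred b) (word as) a) (∑true-word as a))

  length-word : ∀ {j} (s : Vec ℕ j) → All (0 <_) s → length (word s) ≡ suc (Vec.sum s)
  length-word []           []        = refl
  length-word (suc a ∷ as) (_ ∷ pos) = cong suc (begin
    length (replicate a false ++ word as)            ≡⟨ length-++ (replicate a false) ⟩
    length (replicate a false) + length (word as)    ≡⟨ cong₂ _+_ (length-replicate a) (length-word as pos) ⟩
    a + suc (Vec.sum as)                             ≡⟨ +-suc a (Vec.sum as) ⟩
    suc a + Vec.sum as                               ∎)

  -- Ensures that the filter in `S` discards nothing, so a sum over `S s` is a sum over `splits s`.
  splits-positive : ∀ {j} (s : Vec ℕ j) → All (0 <_) s → List.All (All (0 <_)) (splits s)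
  splits-positive []       []          = List.[]
  splits-positive (a ∷ as) (0<a ∷ pos) = List.++⁺
    (List.map⁺ (List.applyUpTo⁺₁ _ (pred a) λ b<a → z<s ∷ m<n⇒0<n∸m (suc< {a} b<a) ∷ pos))
    (List.map⁺ (List.map (0<a ∷_) (splits-positive as pos)))

  -- The cycle of gaps

  module Cycle (k : ℕ) where

    private
      instance _ = Φ-nonZero k

      c : ℕ → Bool
      c = unit k

      f : ℕ → ℕ
      f n = g k (suc n)

      unit-1 : c 1 ≡ true
      unit-1 = dec-true (coprime? 1 (Π k)) (1-coprimeTo (Π k))

      unit-Π+ : ∀ x → c (Π k + x) ≡ c x
      unit-Π+ x = trans (cong (λ m → c (m + x)) (sym (*-identityˡ (Π k)))) (unit-period k 1 x)

      unit-sucΠ : c (suc (Π k)) ≡ true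
      unit-sucΠ = trans (cong c (+-comm 1 (Π k))) (trans (unit-Π+ 1) unit-1)

      -- Both ends of the range, 1 and `Π k + 1`, are coprime to `Π k`, so the differences fill the
      -- interval between them.
      tiles-𝒢 : Tiles c 1 (𝒢 k) (suc (Π k))
      tiles-𝒢 = subst (λ xs → Tiles c 1 (differences xs) (suc (Π k))) (sym coprimes≡)
        (tiles-differences (λ n → coprime? n (Π k)) (Π k) 0 (suc ∘ suc)
          (λ _ → refl) unit-1 (λ ()) refl unit-sucΠ)
        where
        coprimes≡ : coprimes k ≡ 1 ∷ filter (λ n → coprime? n (Π k)) (applyUpTo (suc ∘ suc) (Π k))
        coprimes≡ = trans (cong (λ m → filter (λ n → coprime? n (Π k)) (applyUpTo suc m)) (+-comm (Π k) 1))
          (filter-accept (λ n → coprime? n (Π k)) (1-coprimeTo (Π k)))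

      -- Stated for any tiling by `n` gaps, because its first use is to find the length of `𝒢 k`.
      -- Only the values of `F` at units matter.
      ∑<-units : ∀ (h : ℕ → ℕ) n → Tiles c 1 (applyUpTo h n) (suc (Π k)) → ∀ w (F : ℕ → ℕ) →
        (∀ x → ⟦ c x ⟧ * F x ≡ occ (λ i → c (x + i)) w) →
        ∑< n (λ i → F (suc (∑< i h))) ≡ count k w
      ∑<-units h n tiles w F eq = begin
        ∑< n (λ i → F (suc (∑< i h)))
          ≡⟨ ∑<-tiles h n tiles F ⟩
        ∑< (∑< n h) (λ z → ⟦ c (suc z) ⟧ * F (suc z))
          ≡⟨ cong (λ m → ∑< m (λ z → ⟦ c (suc z) ⟧ * F (suc z))) (suc-injective (tiles-end h n tiles)) ⟨
        ∑< (Π k) (λ z → ⟦ c (suc z) ⟧ * F (suc z))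
          ≡⟨ ∑<-cong (Π k) (eq ∘ suc) ⟩
        ∑< (Π k) (λ z → occ (λ i → c (suc z + i)) w)
          -- The tiling starts at 1 but `count` at 0; periodicity exchanges the positions 0 and
          -- `Π k`.
          ≡⟨ ∑<-shift (Π k) (λ z → occ (λ i → c (z + i)) w) (occ-cong unit-Π+ w) ⟩
        count k w ∎

      length-𝒢 : length (𝒢 k) ≡ Φ k
      length-𝒢 = begin
        length (𝒢 k)             ≡⟨ *-identityʳ _ ⟨
        length (𝒢 k) * 1         ≡⟨ ∑<-const (length (𝒢 k)) 1 ⟨
        ∑< (length (𝒢 k)) (λ _ → 1)
          ≡⟨ ∑<-units (nth (𝒢 k)) (length (𝒢 k))
               (subst (λ ds → Tiles c 1 ds (suc (Π k))) (sym (applyUpTo-nth (𝒢 k))) tiles-𝒢)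
               (true ∷ []) (λ _ → 1) indicator ⟩
        count k (true ∷ [])          ≡⟨ count-unit k ⟩
        Φ k                      ∎
        where
        indicator : ∀ x → ⟦ c x ⟧ * 1 ≡ occ (λ i → c (x + i)) (true ∷ [])
        indicator x rewrite +-identityʳ x with c x
        ... | true  = refl
        ... | false = refl

      𝒢≡ : 𝒢 k ≡ applyUpTo f (Φ k)
      𝒢≡ = begin
        𝒢 k                                       ≡⟨ applyUpTo-nth (𝒢 k) ⟨
        applyUpTo (nth (𝒢 k)) (length (𝒢 k))      ≡⟨ cong (applyUpTo (nth (𝒢 k))) length-𝒢 ⟩
        applyUpTo (nth (𝒢 k)) (Φ k)
          ≡⟨ applyUpTo-cong (Φ k) (λ i<Φ → cong (nth (𝒢 k)) (sym (m<n⇒m%n≡m i<Φ))) ⟩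
        applyUpTo f (Φ k)                         ∎

      tiles : Tiles c 1 (applyUpTo f (Φ k)) (suc (Π k))
      tiles = subst (λ ds → Tiles c 1 ds (suc (Π k))) 𝒢≡ tiles-𝒢

      f-period : ∀ n → f (Φ k + n) ≡ f n
      f-period n = cong (nth (𝒢 k)) (trans (cong (_% Φ k) (+-comm (Φ k) n)) ([m+n]%n≡m%n n (Φ k)))

      -- Advancing by `Φ k` gaps moves the position by their total `Π k`, a period of `c`.
      gap-period : ∀ n → GapAt c (suc (∑< n f)) (f n) → GapAt c (suc (∑< (Φ k + n) f)) (f (Φ k + n))
      gap-period n gap = subst (GapAt c (suc (∑< (Φ k + n) f))) (sym (f-period n))
        (Gap-cong (λ i → sym (begin
          c (suc (∑< (Φ k + n) f) + i)
            ≡⟨ cong (λ m → c (suc m + i)) (trans (∑<-++ (Φ k) n f)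
                 (cong₂ _+_ (sym (suc-injective (tiles-end f (Φ k) tiles))) (∑<-cong n f-period))) ⟩
          c (suc (Π k + ∑< n f) + i)
            ≡⟨ cong c (lem (Π k) (∑< n f) i) ⟩
          c (Π k + (suc (∑< n f) + i))
            ≡⟨ unit-Π+ _ ⟩
          c (suc (∑< n f) + i) ∎)) (f n) gap)
        where
        lem : ∀ a b i → suc (a + b) + i ≡ a + (suc b + i)
        lem = solve-∀

      -- Occurrences may run past the end of the cycle, so every index is covered: the tiling gives
      -- the first period, and `gap-period` carries it to the later ones.
      gaps : ∀ n → GapAt c (suc (∑< n f)) (f n)
      gaps n = subst (λ m → GapAt c (suc (∑< m f)) (f m))
        (trans (+-comm (n / Φ k * Φ k) (n % Φ k)) (sym (m≡m%n+[m/n]*n n (Φ k)))) (go (n / Φ k))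
        where
        go : ∀ t → GapAt c (suc (∑< (t * Φ k + n % Φ k) f)) (f (t * Φ k + n % Φ k))
        go zero    = tiles-gap f (Φ k) tiles (m%n<n n (Φ k))
        go (suc t) = subst (λ m → GapAt c (suc (∑< m f)) (f m)) (sym (+-assoc (Φ k) (t * Φ k) _))
          (gap-period (t * Φ k + n % Φ k) (go t))

    N≡count : ∀ {j} (s : Vec ℕ j) → All (0 <_) s → N k s ≡ count k (word s)
    N≡count s pos = begin
      N k s
        ≡⟨ length-filter-applyUpTo (occursAt? k s) suc (Φ k) ⟩
      ∑< (Φ k) (λ n → ⟦ does (occursAt? k s (suc n)) ⟧)
        ≡⟨ ∑<-cong (Φ k) (λ n → occ-occurs {c} f 1 gaps s pos n (occursAt? k s (suc n))) ⟩
      ∑< (Φ k) (λ n → occ (λ i → c (suc (∑< n f) + i)) (word s))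
        ≡⟨ ∑<-units f (Φ k) tiles (word s) (λ x → occ (λ i → c (x + i)) (word s)) absorb ⟩
      count k (word s) ∎
      where
      -- `word s` begins with true, so its indicator already vanishes unless `c x` holds.
      absorb : ∀ x → ⟦ c x ⟧ * occ (λ i → c (x + i)) (word s) ≡ occ (λ i → c (x + i)) (word s)
      absorb x rewrite +-identityʳ x with c x
      ... | true  = +-identityʳ _
      ... | false = refl

  -- The recurrence for constellations.

  ∑S≡ : ∀ {j} k (s : Vec ℕ j) → All (0 <_) s →
    ∑ (S s) (λ s̄ → N k s̄) ≡ ∑flip (λ _ → count k) (word s)
  ∑S≡ k s pos = begin
    ∑ (S s) (λ s̄ → N k s̄)
      ≡⟨ cong (λ xs → sum (map (λ s̄ → N k s̄) xs)) (filter-all _ (splits-positive s pos)) ⟩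
    sum (map (λ s̄ → N k s̄) (splits s))
      ≡⟨ cong sum (map-cong-local (List.map (λ {s̄} → Cycle.N≡count k s̄) (splits-positive s pos))) ⟩
    sum (map (count k ∘ word) (splits s))
      ≡⟨ ∑flip-word s (count k) ⟨
    ∑flip (λ _ → count k) (word s) ∎

  N-suc : ∀ k → 1 ≤ k → ∀ {j} (s : Vec ℕ j) → All (0 <_) s → Vec.sum s < 2 * p (suc k) →
    N (suc k) s + suc j * N k s ≡ p (suc k) * N k s + ∑ (S s) (λ s̄ → N k s̄)
  N-suc k 1≤k {j} s pos sum<2q = begin
    N (suc k) s + suc j * N k s
      ≡⟨ cong₂ (λ a b → a + suc j * b) (Cycle.N≡count (suc k) s pos) (Cycle.N≡count k s pos) ⟩
    count (suc k) w + suc j * count k w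
      ≡⟨ cong (count (suc k) w +_) (∑true-word s (count k w)) ⟨
    count (suc k) w + ∑true (λ _ → count k w) w
      -- The word is one letter longer than the sum of the gaps, so the strict bound on the sum
      -- gives length at most `2 * p (suc k)`.
      ≡⟨ count-suc k w (atMostOneHit k 1≤k (≤-trans (≤-reflexive (length-word s pos)) sum<2q)) ⟩
    p (suc k) * count k w + ∑flip (λ _ → count k) w
      ≡⟨ cong₂ (λ a b → p (suc k) * a + b) (Cycle.N≡count k s pos) (∑S≡ k s pos) ⟨
    p (suc k) * N k s + ∑ (S s) (λ s̄ → N k s̄) ∎
    where w = word s

open import Data.Integer.Base using (+_; _+_; _-_; _*_)
open import Data.Integer.Properties using (pos-*)
open import Data.Integer.Tactic.RingSolver using (solve-∀)
open import Data.Nat.Base as ℕ using (ℕ; suc; _≤_; _<_)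
open import Data.Nat.Properties using (+-comm)
open import Data.Product.Base using (_,_)
open import Data.Vec.Base as Vec using (Vec)
open import Relation.Binary.PropositionalEquality using (_≡_; cong; subst; module ≡-Reasoning)
open ≡-Reasoning

-- Turns the additive recurrence over ℕ into the stated form, with the subtraction taken in the
-- integers to avoid truncation.
pos-isolate : ∀ a b q n c → a ℕ.+ n ℕ.* b ≡ q ℕ.* b ℕ.+ c → + a ≡ (+ q - + n) * + b + + c
pos-isolate a b q n c eq = begin
  + a                                    ≡⟨ cancel (+ a) (+ n * + b) ⟩
  + a + + n * + b - + n * + b            ≡⟨ cong (λ x → + a + x - + n * + b) (pos-* n b) ⟨
  + (a ℕ.+ n ℕ.* b) - + n * + b          ≡⟨ cong (λ x → + x - + n * + b) eq ⟩
  + (q ℕ.* b) + + c - + n * + b          ≡⟨ cong (λ x → x + + c - + n * + b) (pos-* q b) ⟩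
  + q * + b + + c - + n * + b            ≡⟨ collect (+ q) (+ n) (+ b) (+ c) ⟩
  (+ q - + n) * + b + + c                ∎
  where
  cancel : ∀ x y → x ≡ x + y - y
  cancel = solve-∀
  collect : ∀ q n b c → q * b + c - n * b ≡ (q - n) * b + c
  collect = solve-∀

theorem4p2 : ∀ (k : ℕ) → 1 ≤ k → ∀ (j : ℕ) (s : Vec ℕ j) →
    IsConstellationIn k s →
    Vec.sum s < 2 ℕ.* p (suc k) →
    + N (suc k) s ≡ (+ p (suc k) - + (j ℕ.+ 1)) * + N k s + + ∑ (S s) (λ s̄ → N k s̄)
theorem4p2 k 1≤k j s (pos , _) sum<2q =
  pos-isolate (N (suc k) s) (N k s) (p (suc k)) (j ℕ.+ 1) (∑ (S s) (λ s̄ → N k s̄))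
    (subst (λ n → N (suc k) s ℕ.+ n ℕ.* N k s ≡ p (suc k) ℕ.* N k s ℕ.+ ∑ (S s) (λ s̄ → N k s̄))
      (+-comm 1 j) (N-suc k 1≤k s pos sum<2q))
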